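{- Fix a positive integer $k$ and real numbers $\alpha,\beta\in(0,1)$ with $\alpha+\beta\geq 1$, and let $\ell=\ell(n)$ be positive integers with $\ell(n)/\sqrt{n}\to 0$ as $n\to\infty$. Then for all sufficiently large $n$, writing $M={n\choose k}$, there exists a cyclic ordering $S_0,S_1,\dots,S_{M-1}$ of all $k$-element subsets of $[n]$ (indices taken modulo $M$) such that: (1) for every $i$, the $\ell$ consecutive sets $S_i,S_{i+1},\dots,S_{i+\ell-1}$ are pairwise disjoint, so that $W_i=\{S_i,\dots,S_{i+\ell-1}\}$ is a $(k,\ell)$-parpartition of $[n]$ (a consecutive-$(k,\ell)$-parpartition); and (2) for any two consecutive-$(k,\ell)$-parpartitions $W_i,W_j$ having no $k$-element set in common, $W_i$ and $W_j$ are not $(\alpha,\beta)$-close.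
   Context: $[n]=\{1,\dots,n\}$. A $(k,\ell)$-parpartition of $[n]$ is a family of $\ell$ pairwise disjoint $k$-element subsets of $[n]$. Two such families $P_1,P_2$ are $(\alpha,\beta)$-close if there exist $A_1\neq B_1$ in $P_1$ and $A_2\neq B_2$ in $P_2$ with $|A_1\cap A_2|>\alpha k$ and $|B_1\cap B_2|>\beta k$.
   Formalization: The formal theorem takes α and β to be rational numbers in (0,1) rather than real numbers; the real case follows by raising each slightly to a rational that imposes the same integer threshold on the intersection sizes. -}

module Defs where

open import Data.Nat using (ℕ; zero; suc; _+_; _*_; _^_; _≤_)
open import Data.Nat.DivMod using (_mod_)
open import Data.Fin using (Fin; toℕ)
open import Data.Fin.Subset using (Subset; _∩_; ∣_∣; Empty)
open import Data.Integer using (+_)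
import Data.Rational as ℚ
open ℚ using (ℚ)
open import Data.Product using (Σ; ∃; _×_; ∃-syntax)
open import Relation.Binary.PropositionalEquality using (_≡_; _≢_)
open import Relation.Nullary using (¬_)

nat : ℕ → ℚ
nat m = (+ m) ℚ./ 1

Disjoint : ∀ {n} → Subset n → Subset n → Set
Disjoint A B = Empty (A ∩ B)

-- A family of ℓ subsets of [n], given by an enumeration F : Fin ℓ → Subset n;
-- the family itself is the image of F.
_∈ᶠ_ : ∀ {n ℓ} → Subset n → (Fin ℓ → Subset n) → Set
A ∈ᶠ F = ∃[ t ] (F t ≡ A)

IsParpartition : ∀ {n} (k ℓ : ℕ) → (Fin ℓ → Subset n) → Set
IsParpartition k ℓ F =
  (∀ t → ∣ F t ∣ ≡ k) × (∀ t u → t ≢ u → Disjoint (F t) (F u))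

Close : ∀ {n ℓ} (α β : ℚ) (k : ℕ) → (Fin ℓ → Subset n) → (Fin ℓ → Subset n) → Set
Close {n} α β k P₁ P₂ =
  Σ (Subset n) λ A₁ → Σ (Subset n) λ B₁ → Σ (Subset n) λ A₂ → Σ (Subset n) λ B₂ →
    A₁ ∈ᶠ P₁ × B₁ ∈ᶠ P₁ × A₁ ≢ B₁ ×
    A₂ ∈ᶠ P₂ × B₂ ∈ᶠ P₂ × A₂ ≢ B₂ ×
    (α ℚ.* nat k) ℚ.< nat ∣ A₁ ∩ A₂ ∣ ×
    (β ℚ.* nat k) ℚ.< nat ∣ B₁ ∩ B₂ ∣

NoCommonSet : ∀ {n ℓ} → (Fin ℓ → Subset n) → (Fin ℓ → Subset n) → Set
NoCommonSet {n} P₁ P₂ = ∀ (A : Subset n) → A ∈ᶠ P₁ → ¬ (A ∈ᶠ P₂)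

shift : ∀ {M} → Fin M → ℕ → Fin M
shift {suc m} i j = (toℕ i + j) mod (suc m)

CyclicOrdering : ∀ {M} (n k : ℕ) → (Fin M → Subset n) → Set
CyclicOrdering {M} n k S =
  (∀ i → ∣ S i ∣ ≡ k) ×
  (∀ i j → S i ≡ S j → i ≡ j) ×
  (∀ (A : Subset n) → ∣ A ∣ ≡ k → ∃[ i ] (S i ≡ A))

Window : ∀ {M n} (ℓ : ℕ) → (Fin M → Subset n) → Fin M → (Fin ℓ → Subset n)
Window ℓ S i t = S (shift i (toℕ t))

-- ℓ(n)/√n → 0, expressed equivalently as ℓ(n)²/n → 0:
-- for every c ≥ 1, eventually c·ℓ(n)² ≤ n
SqrtLittleO : (ℕ → ℕ) → Set
SqrtLittleO ℓ = ∀ (c : ℕ) → 1 ≤ c → ∃[ N ] (∀ n → N ≤ n → c * (ℓ n ^ 2) ≤ n)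

{-# OPTIONS --safe #-}

-- Start from any cyclic ordering S of the k-subsets and repair it by transpositions.  Call two
-- positions near if they differ by less than ℓ cyclically.  Since α + β ≥ 1, closeness of two
-- windows without a common set yields four distinct positions with p near q, r near s and
-- |S p ∩ S r| + |S q ∩ S s| > k, so it suffices to avoid such quadruples as well as
-- intersecting sets at near positions.  Swapping the sets at positions i and j puts both
-- positions in order, and spoils no other position, unless j lies in an exceptional list whose
-- length is O(ℓ² n^(k-1)): fixing q near i and the overlap b = |S q ∩ S s| ≥ 1 leaves
-- O(n^(k-b)) sets S s, then O(ℓ) positions r, then O(n^(b-1)) sets meeting S r in at least
-- k + 1 - b points.  As ℓ² = o(n), this is less than n C k, so every position can be
-- repaired in turn.  Nearby sets are made disjoint in a first pass over all positions; the second
-- pass needs this for the quadruples (i, q, r, j) that contain both swapped positions.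
module Submission where

open import Defs
open import Data.Nat using (ℕ; _≤_)
open import Data.Nat.Combinatorics using (_C_)
open import Data.Fin using (Fin)
open import Data.Fin.Subset using (Subset)
open import Data.Rational using (ℚ; 0ℚ; 1ℚ; _<_; _+_)
open import Data.Product using (Σ; ∃-syntax; _×_)
open import Relation.Nullary using (¬_)

import Data.Bool as Bool
import Data.Fin as Fin
import Data.Fin.Properties as Fin
open import Data.Fin using (zero; suc; toℕ)
open import Data.Fin.Permutation.Components using (transpose; transpose-inverse)
open import Data.Fin.Subset using (inside; outside; _∩_; ∣_∣; ⊥; Empty)
import Data.Fin.Subset as Subset
open import Data.Fin.Subset.Properties
  using (x∈p∩q⁻; ∣p∩q∣≤∣p∣; ∩-comm; Empty-unique)
open import Data.Integer using (+_)
import Data.Integer as ℤ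
import Data.Integer.Properties as ℤ
open import Data.List
  using (List; []; _∷_; [_]; _++_; length; map; concatMap; allFin; upTo; lookup)
import Data.List.Properties as List
open import Data.List.Membership.Propositional using (_∈_; _∉_; lose)
open import Data.List.Membership.Propositional.Properties
import Data.List.Membership.DecPropositional as DecMembership
import Data.List.Relation.Unary.All as All
open import Data.List.Relation.Unary.All using ([]; _∷_)
open import Data.List.Relation.Unary.Any using (here; there; index)
open import Data.List.Relation.Unary.Any.Properties using (lookup-index)
open import Data.List.Relation.Unary.Unique.Propositional using (Unique; []; _∷_)
import Data.List.Relation.Unary.Unique.Propositional.Properties as Unique
open import Data.Nat as ℕ
  using (zero; suc; pred; _*_; _^_; _∸_; _!; _⊔_; z≤n; s≤s; z<s; NonZero; >-nonZero)
open import Data.Nat.Combinatorics using (nCk+nC[k+1]≡[n+1]C[k+1])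
open import Data.Nat.Combinatorics.Specification using (k>n⇒nCk≡0)
open import Data.Nat.DivMod
open import Data.Nat.Properties
open import Data.Nat.Tactic.RingSolver using (solve-∀)
open import Data.Product using (_,_; proj₁; proj₂)
open import Data.Rational using (toℚᵘ)
import Data.Rational as ℚ
import Data.Rational.Properties as ℚ
import Data.Rational.Unnormalised as ℚᵘ
import Data.Rational.Unnormalised.Properties as ℚᵘ
open import Data.Sum using (_⊎_; inj₁; inj₂)
open import Data.Vec using ([]; _∷_; here; there; _[_]≔_)
import Data.Vec.Properties as Vec
open import Function using (_∘_; id; _$_)
open import Relation.Binary.PropositionalEquality
  using (_≡_; _≢_; refl; sym; trans; cong; cong₂; subst; subst₂; ≢-sym; module ≡-Reasoning)
open import Relation.Nullary using (Dec; yes; no; contradiction)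
open import Relation.Nullary.Decidable using (dec-true; dec-false)

-- Rational fractions and integer overlaps

nat-fromℚᵘ : ∀ m → toℚᵘ (nat m) ℚᵘ.≃ (+ m) ℚᵘ./ 1
nat-fromℚᵘ m = ℚ.toℚᵘ-fromℚᵘ ((+ m) ℚᵘ./ 1)

nat-mono : ∀ {a b} → a ≤ b → nat a ℚ.≤ nat b
nat-mono {a} {b} a≤b = ℚ.toℚᵘ-cancel-≤ (begin
  toℚᵘ (nat a)   ≃⟨ nat-fromℚᵘ a ⟩
  (+ a) ℚᵘ./ 1   ≤⟨ ℚᵘ.*≤* (ℤ.*-monoʳ-≤-nonNeg (+ 1) (ℤ.+≤+ a≤b)) ⟩
  (+ b) ℚᵘ./ 1   ≃⟨ nat-fromℚᵘ b ⟨
  toℚᵘ (nat b)   ∎)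
  where open ℚᵘ.≤-Reasoning

nat-+ : ∀ a b → nat (a ℕ.+ b) ≡ nat a + nat b
nat-+ a b = ℚ.toℚᵘ-injective (begin
  toℚᵘ (nat (a ℕ.+ b))                   ≈⟨ nat-fromℚᵘ (a ℕ.+ b) ⟩
  (+ (a ℕ.+ b)) ℚᵘ./ 1                   ≈⟨ ℚᵘ.*≡* (cong (ℤ._* (+ 1)) (cong₂ ℤ._+_ (sym (ℤ.*-identityʳ (+ a))) (sym (ℤ.*-identityʳ (+ b))))) ⟩
  (+ a) ℚᵘ./ 1 ℚᵘ.+ (+ b) ℚᵘ./ 1         ≈⟨ ℚᵘ.+-cong (nat-fromℚᵘ a) (nat-fromℚᵘ b) ⟨
  toℚᵘ (nat a) ℚᵘ.+ toℚᵘ (nat b)         ≈⟨ ℚ.toℚᵘ-homo-+ (nat a) (nat b) ⟨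
  toℚᵘ (nat a + nat b)                   ∎)
  where open ℚᵘ.≃-Reasoning

-- Adding the two strict inequalities gives a + b > (α + β)k ≥ k. The fractions enter the
-- combinatorics only through this integer inequality.
fractions-exceed : ∀ {α β : ℚ} {k a b} → 1ℚ ℚ.≤ α + β →
  α ℚ.* nat k < nat a → β ℚ.* nat k < nat b → k ℕ.< a ℕ.+ b
fractions-exceed {α} {β} {k} {a} {b} 1≤α+β αk<a βk<b =
  ≰⇒> λ a+b≤k → ℚ.<-irrefl refl (ℚ.<-≤-trans k<a+b (nat-mono a+b≤k))
  where
  open ℚ.≤-Reasoning
  instance
    nonNeg : ℚ.NonNegative (nat k)
    nonNeg = ℚ.nonNegative (nat-mono {0} {k} z≤n)
  k<a+b : nat k < nat (a ℕ.+ b)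
  k<a+b = begin-strict
    nat k                       ≡⟨ ℚ.*-identityˡ (nat k) ⟨
    1ℚ ℚ.* nat k                ≤⟨ ℚ.*-monoʳ-≤-nonNeg (nat k) 1≤α+β ⟩
    (α + β) ℚ.* nat k           ≡⟨ ℚ.*-distribʳ-+ (nat k) α β ⟩
    α ℚ.* nat k + β ℚ.* nat k   <⟨ ℚ.+-mono-< αk<a βk<b ⟩
    nat a + nat b               ≡⟨ nat-+ a b ⟨
    nat (a ℕ.+ b)               ∎

-- Binomial coefficients

-- This is (k + 1) C(n, k + 1) = (n - k) C(n, k) freed of subtraction. By Pascal's rule the case (n
-- + 1, k + 1) is the sum of the cases (n, k + 1) and (n, k), with a + b added on both sides.
[k+1]C[k+1]+kCk≡nCk : ∀ n k → suc k * (n C suc k) ℕ.+ k * (n C k) ≡ n * (n C k)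
[k+1]C[k+1]+kCk≡nCk zero zero = refl
[k+1]C[k+1]+kCk≡nCk zero (suc k)
  rewrite k>n⇒nCk≡0 {0} {suc (suc k)} z<s | k>n⇒nCk≡0 {0} {suc k} z<s
        | *-zeroʳ k = refl
[k+1]C[k+1]+kCk≡nCk (suc n) zero
  rewrite sym (nCk+nC[k+1]≡[n+1]C[k+1] n 0) = begin
  1 * (1 ℕ.+ n C 1) ℕ.+ 0                     ≡⟨ lemma (n C 1) ⟩
  1 ℕ.+ (1 * (n C 1) ℕ.+ 0 * (n C 0))         ≡⟨ cong (1 ℕ.+_) ([k+1]C[k+1]+kCk≡nCk n 0) ⟩
  1 ℕ.+ n * 1                                 ∎
  where
  open ≡-Reasoning
  lemma : ∀ x → 1 * (1 ℕ.+ x) ℕ.+ 0 ≡ 1 ℕ.+ (1 * x ℕ.+ 0 * 1)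
  lemma = solve-∀
[k+1]C[k+1]+kCk≡nCk (suc n) (suc k)
  rewrite sym (nCk+nC[k+1]≡[n+1]C[k+1] n (suc k)) | sym (nCk+nC[k+1]≡[n+1]C[k+1] n k) = begin
  suc (suc k) * (b ℕ.+ c) ℕ.+ suc k * (a ℕ.+ b)
    ≡⟨ split a b c k ⟩
  (suc (suc k) * c ℕ.+ suc k * b) ℕ.+ (suc k * b ℕ.+ k * a) ℕ.+ (a ℕ.+ b)
    ≡⟨ cong₂ (λ x y → x ℕ.+ y ℕ.+ (a ℕ.+ b)) ([k+1]C[k+1]+kCk≡nCk n (suc k)) ([k+1]C[k+1]+kCk≡nCk n k) ⟩
  n * b ℕ.+ n * a ℕ.+ (a ℕ.+ b)
    ≡⟨ join a b n ⟩
  suc n * (a ℕ.+ b) ∎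
  where
  open ≡-Reasoning
  a b c : ℕ
  a = n C k
  b = n C suc k
  c = n C suc (suc k)
  split : ∀ a b c k → suc (suc k) * (b ℕ.+ c) ℕ.+ suc k * (a ℕ.+ b)
    ≡ (suc (suc k) * c ℕ.+ suc k * b) ℕ.+ (suc k * b ℕ.+ k * a) ℕ.+ (a ℕ.+ b)
  split = solve-∀
  join : ∀ a b n → n * b ℕ.+ n * a ℕ.+ (a ℕ.+ b) ≡ suc n * (a ℕ.+ b)
  join = solve-∀

-- In the product formula for C(n, k) every factor n - i with i < k is at least n / 2.
n^k≤2^k*k!*nCk : ∀ n k → 2 * k ≤ n → n ^ k ≤ 2 ^ k * k ! * (n C k)
n^k≤2^k*k!*nCk n zero _ = ≤-refl
n^k≤2^k*k!*nCk n (suc k) 2k+2≤n = begin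
  n * n ^ k                                 ≤⟨ *-monoʳ-≤ n (n^k≤2^k*k!*nCk n k 2k≤n) ⟩
  n * (2 ^ k * k ! * (n C k))               ≡⟨ swap n (2 ^ k * k !) (n C k) ⟩
  2 ^ k * k ! * (n * (n C k))               ≤⟨ *-monoʳ-≤ (2 ^ k * k !) step ⟩
  2 ^ k * k ! * (2 * (suc k * (n C suc k))) ≡⟨ arrange (2 ^ k) (k !) k (n C suc k) ⟩
  2 ^ suc k * suc k ! * (n C suc k)         ∎
  where
  open ≤-Reasoning
  2k≤n : 2 * k ≤ n
  2k≤n = ≤-trans (*-monoʳ-≤ 2 (n≤1+n k)) 2k+2≤n
  swap : ∀ a b c → a * (b * c) ≡ b * (a * c)
  swap = solve-∀
  arrange : ∀ a b k c → a * b * (2 * (suc k * c)) ≡ (2 * a) * (suc k * b) * c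
  arrange = solve-∀
  double : ∀ k x y → 2 * (k * x) ℕ.+ 2 * y ≡ 2 * (y ℕ.+ k * x)
  double = solve-∀
  step : n * (n C k) ≤ 2 * (suc k * (n C suc k))
  -- With n C(n, k) added on both sides the identity above applies as it stands, and 2k ≤ n absorbs
  -- the term 2k C(n, k).
  step = +-cancelˡ-≤ (n * (n C k)) _ _ (begin
    n * (n C k) ℕ.+ n * (n C k)                       ≡⟨ cong (n * (n C k) ℕ.+_) (+-identityʳ _) ⟨
    2 * (n * (n C k))                                 ≡⟨ cong (2 *_) ([k+1]C[k+1]+kCk≡nCk n k) ⟨
    2 * (suc k * (n C suc k) ℕ.+ k * (n C k))         ≡⟨ double k (n C k) (suc k * (n C suc k)) ⟨
    2 * (k * (n C k)) ℕ.+ 2 * (suc k * (n C suc k))   ≡⟨ cong (ℕ._+ 2 * (suc k * (n C suc k))) (*-assoc 2 k (n C k)) ⟨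
    2 * k * (n C k) ℕ.+ 2 * (suc k * (n C suc k))     ≤⟨ +-monoˡ-≤ _ (*-monoˡ-≤ (n C k) 2k≤n) ⟩
    n * (n C k) ℕ.+ 2 * (suc k * (n C suc k))         ∎)

-- Lists

opaque
  -- Sealed, so that the nested exclusion lists below are handled only through membership and the
  -- length bound.
  union : {A B : Set} → (A → List B) → List A → List B
  union = concatMap

  ∈-union : {A B : Set} (f : A → List B) → ∀ {x y xs} → x ∈ xs → y ∈ f x → y ∈ union f xs
  ∈-union f x∈xs y∈fx = ∈-concatMap⁺ f (lose x∈xs y∈fx)

  length-union : {A B : Set} (f : A → List B) → ∀ {a b} xs → length xs ≤ a →
    (∀ x → length (f x) ≤ b) → length (union f xs) ≤ a * b
  length-union f [] _ _ = z≤n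
  length-union f {suc a} (x ∷ xs) (s≤s xs≤a) f≤b
    rewrite List.length-++ (f x) {union f xs} =
    +-mono-≤ (f≤b x) (length-union f xs xs≤a f≤b)

length-++-≤ : ∀ {A : Set} {a b} (xs ys : List A) → length xs ≤ a → length ys ≤ b →
  length (xs ++ ys) ≤ a ℕ.+ b
length-++-≤ xs ys xs≤a ys≤b rewrite List.length-++ xs {ys} = +-mono-≤ xs≤a ys≤b

-- Pigeonhole: if every element occurred, its index would inject `Fin M` into the places of the
-- list. Repetitions do no harm.
short-list-misses : ∀ {M} (xs : List (Fin M)) → length xs ℕ.< M → ∃[ j ] j ∉ xs
short-list-misses {M} xs short = Fin.¬∀⟶∃¬ M (_∈ xs) (_∈? xs) λ all →
  <⇒≱ short (Fin.injective⇒≤ {f = index ∘ all} λ {i} {j} eq →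
    trans (lookup-index (all i)) (trans (cong (lookup xs) eq) (sym (lookup-index (all j)))))
  where open DecMembership (Fin._≟_ {M}) using (_∈?_)

-- Finite sets

≡-dec-Subset : ∀ {n} (A B : Subset n) → Dec (A ≡ B)
≡-dec-Subset = Vec.≡-dec Bool._≟_

∣p∣>0⇒nonempty : ∀ {n} {p : Subset n} → 1 ≤ ∣ p ∣ → Subset.Nonempty p
∣p∣>0⇒nonempty {p = inside ∷ p} _ = zero , here
∣p∣>0⇒nonempty {p = outside ∷ p} p>0 with x , x∈p ← ∣p∣>0⇒nonempty p>0 = suc x , there x∈p

∣p∣≡0⇒Empty : ∀ {n} {p : Subset n} → ∣ p ∣ ≡ 0 → Empty p
∣p∣≡0⇒Empty {p = inside ∷ p} () _
∣p∣≡0⇒Empty {p = outside ∷ p} ∣p∣≡0 (suc x , there x∈p) = ∣p∣≡0⇒Empty ∣p∣≡0 (x , x∈p)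

∣p∣≡0⇒p≡⊥ : ∀ {n} {p : Subset n} → ∣ p ∣ ≡ 0 → p ≡ ⊥
∣p∣≡0⇒p≡⊥ = Empty-unique ∘ ∣p∣≡0⇒Empty

∣p∣≡1+∣p-x∣ : ∀ {n} {p : Subset n} {x} → x Subset.∈ p → ∣ p ∣ ≡ suc ∣ p [ x ]≔ outside ∣
∣p∣≡1+∣p-x∣ here = refl
∣p∣≡1+∣p-x∣ {p = inside ∷ p} (there x∈p) = cong suc (∣p∣≡1+∣p-x∣ x∈p)
∣p∣≡1+∣p-x∣ {p = outside ∷ p} (there x∈p) = ∣p∣≡1+∣p-x∣ x∈p

[p-x]+x≡p : ∀ {n} {p : Subset n} {x} → x Subset.∈ p → (p [ x ]≔ outside) [ x ]≔ inside ≡ p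
[p-x]+x≡p here = refl
[p-x]+x≡p {p = s ∷ p} (there x∈p) = cong (s ∷_) ([p-x]+x≡p x∈p)

[p-x]∩q≡[p∩q]-x : ∀ {n} (p q : Subset n) x → (p [ x ]≔ outside) ∩ q ≡ (p ∩ q) [ x ]≔ outside
[p-x]∩q≡[p∩q]-x (s ∷ p) (t ∷ q) zero = refl
[p-x]∩q≡[p∩q]-x (s ∷ p) (t ∷ q) (suc x) = cong (_ ∷_) ([p-x]∩q≡[p∩q]-x p q x)

elements : ∀ {n} → Subset n → List (Fin n)
elements [] = []
elements (inside ∷ p) = zero ∷ map suc (elements p)
elements (outside ∷ p) = map suc (elements p)

length-elements : ∀ {n} (p : Subset n) → length (elements p) ≡ ∣ p ∣
length-elements [] = refl
length-elements (inside ∷ p) = cong suc (trans (List.length-map suc (elements p)) (length-elements p))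
length-elements (outside ∷ p) = trans (List.length-map suc (elements p)) (length-elements p)

∈-elements : ∀ {n} {p : Subset n} {x} → x Subset.∈ p → x ∈ elements p
∈-elements here = here refl
∈-elements {p = inside ∷ p} (there x∈p) = there (∈-map⁺ suc (∈-elements x∈p))
∈-elements {p = outside ∷ p} (there x∈p) = ∈-map⁺ suc (∈-elements x∈p)

-- Lists, with repetitions and junk, all sets made of a elements of X and m arbitrary elements.
overlapping : ∀ {n} → Subset n → (a m : ℕ) → List (Subset n)
overlapping X zero zero = [ ⊥ ]
overlapping X zero (suc m) =
  union (λ x → map (_[ x ]≔ inside) (overlapping X zero m)) (allFin _)
overlapping X (suc a) m =
  union (λ x → map (_[ x ]≔ inside) (overlapping X a m)) (elements X)

length-overlapping : ∀ {n} (X : Subset n) a m → length (overlapping X a m) ≤ ∣ X ∣ ^ a * n ^ m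
length-overlapping X zero zero = ≤-refl
length-overlapping {n} X zero (suc m) = ≤-trans
  (length-union _ {a = n} (allFin n) (≤-reflexive (List.length-tabulate id))
    λ x → ≤-trans (≤-reflexive (List.length-map _ (overlapping X zero m))) (length-overlapping X zero m))
  (≤-reflexive (lemma n (n ^ m)))
  where
  lemma : ∀ n u → n * (1 * u) ≡ 1 * (n * u)
  lemma = solve-∀
length-overlapping {n} X (suc a) m = ≤-trans
  (length-union _ (elements X) (≤-reflexive (length-elements X))
    λ x → ≤-trans (≤-reflexive (List.length-map _ (overlapping X a m))) (length-overlapping X a m))
  (≤-reflexive (sym (*-assoc ∣ X ∣ (∣ X ∣ ^ a) (n ^ m))))

-- Remove the elements of A one at a time, first a of them from A ∩ X, which lowers size and overlap
-- together, then m arbitrary ones. Putting them back rebuilds A as an entry of the list.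
∈-overlapping : ∀ {n} {A X : Subset n} a m → ∣ A ∣ ≡ a ℕ.+ m → a ≤ ∣ A ∩ X ∣ → A ∈ overlapping X a m
∈-overlapping zero zero ∣A∣≡0 _ = here (∣p∣≡0⇒p≡⊥ ∣A∣≡0)
∈-overlapping {A = A} {X} zero (suc m) ∣A∣≡1+m _
  with x , x∈A ← ∣p∣>0⇒nonempty (subst (1 ≤_) (sym ∣A∣≡1+m) (s≤s z≤n)) =
  ∈-union (λ x → map (_[ x ]≔ inside) (overlapping X zero m)) (∈-allFin x)
    (subst (_∈ map (_[ x ]≔ inside) (overlapping X zero m)) ([p-x]+x≡p x∈A) (∈-map⁺ _
      (∈-overlapping zero m (suc-injective (trans (sym (∣p∣≡1+∣p-x∣ x∈A)) ∣A∣≡1+m)) z≤n)))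
∈-overlapping {A = A} {X} (suc a) m ∣A∣≡1+a+m a<∣A∩X∣
  with x , x∈A∩X ← ∣p∣>0⇒nonempty (≤-trans (s≤s z≤n) a<∣A∩X∣) =
  ∈-union (λ x → map (_[ x ]≔ inside) (overlapping X a m)) (∈-elements x∈X)
    (subst (_∈ map (_[ x ]≔ inside) (overlapping X a m)) ([p-x]+x≡p x∈A) (∈-map⁺ _
      (∈-overlapping a m (suc-injective (trans (sym (∣p∣≡1+∣p-x∣ x∈A)) ∣A∣≡1+a+m)) a≤)))
  where
  x∈A = proj₁ (x∈p∩q⁻ A X x∈A∩X)
  x∈X = proj₂ (x∈p∩q⁻ A X x∈A∩X)
  a≤ : a ≤ ∣ (A [ x ]≔ outside) ∩ X ∣
  a≤ rewrite [p-x]∩q≡[p∩q]-x A X x =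
    ℕ.s≤s⁻¹ (subst (suc a ≤_) (∣p∣≡1+∣p-x∣ x∈A∩X) a<∣A∩X∣)

-- All k-subsets of [n]

kSubsets : ∀ n → ℕ → List (Subset n)
kSubsets zero zero = [ [] ]
kSubsets zero (suc k) = []
kSubsets (suc n) zero = map (outside ∷_) (kSubsets n zero)
kSubsets (suc n) (suc k) = map (inside ∷_) (kSubsets n k) ++ map (outside ∷_) (kSubsets n (suc k))

length-kSubsets : ∀ n k → length (kSubsets n k) ≡ n C k
length-kSubsets zero zero = refl
length-kSubsets zero (suc k) = sym (k>n⇒nCk≡0 {0} {suc k} z<s)
length-kSubsets (suc n) zero =
  trans (List.length-map (outside ∷_) (kSubsets n 0)) (length-kSubsets n 0)
length-kSubsets (suc n) (suc k) = begin
  length (map (inside ∷_) (kSubsets n k) ++ map (outside ∷_) (kSubsets n (suc k)))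
    ≡⟨ List.length-++ (map (inside ∷_) (kSubsets n k)) ⟩
  length (map (inside ∷_) (kSubsets n k)) ℕ.+ length (map (outside ∷_) (kSubsets n (suc k)))
    ≡⟨ cong₂ ℕ._+_ (List.length-map _ (kSubsets n k)) (List.length-map _ (kSubsets n (suc k))) ⟩
  length (kSubsets n k) ℕ.+ length (kSubsets n (suc k))
    ≡⟨ cong₂ ℕ._+_ (length-kSubsets n k) (length-kSubsets n (suc k)) ⟩
  n C k ℕ.+ n C suc k
    ≡⟨ nCk+nC[k+1]≡[n+1]C[k+1] n k ⟩
  suc n C suc k ∎
  where open ≡-Reasoning

∈-kSubsets⁺ : ∀ {n} (A : Subset n) → A ∈ kSubsets n ∣ A ∣
∈-kSubsets⁺ [] = here refl
∈-kSubsets⁺ (inside ∷ A) = ∈-++⁺ˡ (∈-map⁺ (inside ∷_) (∈-kSubsets⁺ A))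
-- The list for `suc n` unfolds only once the size is known to be zero or a successor.
∈-kSubsets⁺ {suc n} (outside ∷ A) with ∣ A ∣ | ∈-kSubsets⁺ A
... | zero  | A∈ = ∈-map⁺ (outside ∷_) A∈
... | suc k | A∈ = ∈-++⁺ʳ (map (inside ∷_) (kSubsets n k)) (∈-map⁺ (outside ∷_) A∈)

∈-kSubsets⁻ : ∀ n k {A : Subset n} → A ∈ kSubsets n k → ∣ A ∣ ≡ k
∈-kSubsets⁻ zero zero (here refl) = refl
∈-kSubsets⁻ (suc n) zero A∈ with B , B∈ , refl ← ∈-map⁻ (outside ∷_) A∈ = ∈-kSubsets⁻ n zero B∈
∈-kSubsets⁻ (suc n) (suc k) A∈ with ∈-++⁻ (map (inside ∷_) (kSubsets n k)) A∈
... | inj₁ A∈ˡ with B , B∈ , refl ← ∈-map⁻ (inside ∷_) A∈ˡ = cong suc (∈-kSubsets⁻ n k B∈)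
... | inj₂ A∈ʳ with B , B∈ , refl ← ∈-map⁻ (outside ∷_) A∈ʳ = ∈-kSubsets⁻ n (suc k) B∈

kSubsets-unique : ∀ n k → Unique (kSubsets n k)
kSubsets-unique zero zero = [] ∷ []
kSubsets-unique zero (suc k) = []
kSubsets-unique (suc n) zero = Unique.map⁺ Vec.∷-injectiveʳ (kSubsets-unique n zero)
kSubsets-unique (suc n) (suc k) = Unique.++⁺
  (Unique.map⁺ Vec.∷-injectiveʳ (kSubsets-unique n k))
  (Unique.map⁺ Vec.∷-injectiveʳ (kSubsets-unique n (suc k)))
  disjoint
  where
  disjoint : ∀ {A} → ¬ (A ∈ map (inside ∷_) (kSubsets n k) × A ∈ map (outside ∷_) (kSubsets n (suc k)))
  disjoint (A∈ˡ , A∈ʳ) with ∈-map⁻ (inside ∷_) A∈ˡ | ∈-map⁻ (outside ∷_) A∈ʳ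
  ... | B , _ , refl | _ , _ , ()

unique⇒lookup-injective : ∀ {A : Set} {xs : List A} → Unique xs →
  ∀ i j → lookup xs i ≡ lookup xs j → i ≡ j
unique⇒lookup-injective (x∉xs ∷ u) zero zero _ = refl
unique⇒lookup-injective (x∉xs ∷ u) zero (suc j) eq = contradiction eq (All.lookup x∉xs (∈-lookup j))
unique⇒lookup-injective (x∉xs ∷ u) (suc i) zero eq = contradiction (sym eq) (All.lookup x∉xs (∈-lookup i))
unique⇒lookup-injective (x∉xs ∷ u) (suc i) (suc j) eq = cong suc (unique⇒lookup-injective u i j eq)

-- The length is abstracted to `M` so that its equation can be matched with `refl`; for `kSubsets`
-- it is a theorem, not a computation.
list⇒CyclicOrdering : ∀ {n k M} (xs : List (Subset n)) → length xs ≡ M → Unique xs →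
  (∀ {A} → A ∈ xs → ∣ A ∣ ≡ k) → (∀ A → ∣ A ∣ ≡ k → A ∈ xs) →
  Σ (Fin M → Subset n) (CyclicOrdering n k)
list⇒CyclicOrdering xs refl unique sound complete =
  lookup xs ,
  (λ i → sound (∈-lookup i)) ,
  (λ i j → unique⇒lookup-injective unique i j) ,
  λ A ∣A∣≡k → index (complete A ∣A∣≡k) , sym (lookup-index (complete A ∣A∣≡k))

initialOrdering : ∀ n k → Σ (Fin (n C k) → Subset n) (CyclicOrdering n k)
initialOrdering n k = list⇒CyclicOrdering (kSubsets n k) (length-kSubsets n k) (kSubsets-unique n k)
  (∈-kSubsets⁻ n k) λ A ∣A∣≡k → subst (λ k → A ∈ kSubsets n k) ∣A∣≡k (∈-kSubsets⁺ A)

-- Cyclic neighbourhoods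

toℕ-shift : ∀ {m} (p : Fin (suc m)) c → toℕ (shift p c) ≡ (toℕ p ℕ.+ c) % suc m
toℕ-shift {m} p c = Fin.toℕ-fromℕ< (m%n<n (toℕ p ℕ.+ c) (suc m))

shift-shift : ∀ {M} (p : Fin M) c d → shift (shift p c) d ≡ shift p (c ℕ.+ d)
shift-shift {suc m} p c d = Fin.toℕ-injective (begin
  toℕ (shift (shift p c) d)                       ≡⟨ toℕ-shift (shift p c) d ⟩
  (toℕ (shift p c) ℕ.+ d) % suc m                 ≡⟨ cong (λ x → (x ℕ.+ d) % suc m) (toℕ-shift p c) ⟩
  ((toℕ p ℕ.+ c) % suc m ℕ.+ d) % suc m           ≡⟨ %-distribˡ-+ ((toℕ p ℕ.+ c) % suc m) d (suc m) ⟩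
  ((toℕ p ℕ.+ c) % suc m % suc m ℕ.+ d % suc m) % suc m
    ≡⟨ cong (λ x → (x ℕ.+ d % suc m) % suc m) (m%n%n≡m%n (toℕ p ℕ.+ c) (suc m)) ⟩
  ((toℕ p ℕ.+ c) % suc m ℕ.+ d % suc m) % suc m   ≡⟨ %-distribˡ-+ (toℕ p ℕ.+ c) d (suc m) ⟨
  (toℕ p ℕ.+ c ℕ.+ d) % suc m                     ≡⟨ cong (_% suc m) (+-assoc (toℕ p) c d) ⟩
  (toℕ p ℕ.+ (c ℕ.+ d)) % suc m                   ≡⟨ toℕ-shift p (c ℕ.+ d) ⟨
  toℕ (shift p (c ℕ.+ d))                         ∎)
  where open ≡-Reasoning

-- Shifting by pred M * c undoes shifting by c.
shift-inverse : ∀ {M} (p : Fin M) c → shift p (c ℕ.+ pred M * c) ≡ p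
shift-inverse {suc m} p c = Fin.toℕ-injective (begin
  toℕ (shift p (suc m * c))         ≡⟨ toℕ-shift p (suc m * c) ⟩
  (toℕ p ℕ.+ suc m * c) % suc m     ≡⟨ cong (λ x → (toℕ p ℕ.+ x) % suc m) (*-comm (suc m) c) ⟩
  (toℕ p ℕ.+ c * suc m) % suc m     ≡⟨ [m+kn]%n≡m%n (toℕ p) c (suc m) ⟩
  toℕ p % suc m                     ≡⟨ m<n⇒m%n≡m (Fin.toℕ<n p) ⟩
  toℕ p                             ∎)
  where open ≡-Reasoning

-- A further shift by `m * toℕ p` cancels p modulo `suc m`, so it takes `shift p c` to position c,
-- where c can be read off.
shift-injective : ∀ {M} (p : Fin M) {c d} → c ℕ.< M → d ℕ.< M → shift p c ≡ shift p d → c ≡ d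
shift-injective {suc m} p {c} {d} c<M d<M eq =
  trans (sym (back c<M)) (trans (cong (λ q → toℕ (shift q (m * toℕ p))) eq) (back d<M))
  where
  open ≡-Reasoning
  arrange : ∀ x c m → x ℕ.+ (c ℕ.+ m * x) ≡ c ℕ.+ x * suc m
  arrange = solve-∀
  back : ∀ {c} → c ℕ.< suc m → toℕ (shift (shift p c) (m * toℕ p)) ≡ c
  back {c} c<M = begin
    toℕ (shift (shift p c) (m * toℕ p))             ≡⟨ cong toℕ (shift-shift p c (m * toℕ p)) ⟩
    toℕ (shift p (c ℕ.+ m * toℕ p))                 ≡⟨ toℕ-shift p _ ⟩
    (toℕ p ℕ.+ (c ℕ.+ m * toℕ p)) % suc m           ≡⟨ cong (_% suc m) (arrange (toℕ p) c m) ⟩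
    (c ℕ.+ toℕ p * suc m) % suc m                   ≡⟨ [m+kn]%n≡m%n c (toℕ p) (suc m) ⟩
    c % suc m                                       ≡⟨ m<n⇒m%n≡m c<M ⟩
    c                                               ∎

opaque
  -- A list rather than an inequality between indices: membership serves as nearness, and the length
  -- bounds the number of choices. The second half holds the backward shifts.
  neighbours : ∀ {M} → ℕ → Fin M → List (Fin M)
  neighbours {M} ℓ p = map (shift p) (upTo ℓ) ++ map (λ c → shift p (pred M * c)) (upTo ℓ)

Near : ∀ {M} → ℕ → Fin M → Fin M → Set
Near ℓ p q = q ∈ neighbours ℓ p

opaque
  unfolding neighbours

  length-neighbours : ∀ {M} ℓ (p : Fin M) → length (neighbours ℓ p) ≤ ℓ ℕ.+ ℓ
  length-neighbours {M} ℓ p = length-++-≤ (map (shift p) (upTo ℓ)) _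
    (≤-reflexive (trans (List.length-map (shift p) (upTo ℓ)) (List.length-upTo ℓ)))
    (≤-reflexive (trans (List.length-map (λ c → shift p (pred M * c)) (upTo ℓ)) (List.length-upTo ℓ)))

  near-shiftʳ : ∀ {M ℓ c} (p : Fin M) → c ℕ.< ℓ → Near ℓ p (shift p c)
  near-shiftʳ p c<ℓ = ∈-++⁺ˡ (∈-map⁺ (shift p) (∈-upTo⁺ c<ℓ))

  near-shiftˡ : ∀ {M ℓ c} (p : Fin M) → c ℕ.< ℓ → Near ℓ (shift p c) p
  near-shiftˡ {M} {ℓ} {c} p c<ℓ = ∈-++⁺ʳ _ (subst (_∈ map back (upTo ℓ))
    (trans (shift-shift p c (pred M * c)) (shift-inverse p c)) (∈-map⁺ back (∈-upTo⁺ c<ℓ)))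
    where
    back : ℕ → Fin M
    back d = shift (shift p c) (pred M * d)

  near-sym : ∀ {M ℓ} {p q : Fin M} → Near ℓ p q → Near ℓ q p
  near-sym {M} {ℓ} {p} near with ∈-++⁻ (map (shift p) (upTo ℓ)) near
  ... | inj₁ forward with c , c∈ , refl ← ∈-map⁻ (shift p) forward = near-shiftˡ p (∈-upTo⁻ c∈)
  ... | inj₂ backward with c , c∈ , refl ← ∈-map⁻ (λ c → shift p (pred M * c)) backward =
    subst (Near ℓ _) p≡ (near-shiftʳ (shift p (pred M * c)) (∈-upTo⁻ c∈))
    where
    p≡ : shift (shift p (pred M * c)) c ≡ p
    p≡ = trans (shift-shift p (pred M * c) c)
      (trans (cong (shift p) (+-comm (pred M * c) c)) (shift-inverse p c))

module _ {M ℓ : ℕ} where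

  near-refl : 1 ≤ ℓ → (p : Fin M) → Near ℓ p p
  near-refl 1≤ℓ p = subst (Near ℓ p) p≡ (near-shiftʳ p 1≤ℓ)
    where
    p≡ : shift p 0 ≡ p
    -- The shift 0 is rewritten as `0 + pred M * 0` to fit `shift-inverse`.
    p≡ = trans (cong (shift p) (sym (*-zeroʳ (pred M)))) (shift-inverse p 0)

  near-ordered : (p : Fin M) {c d : ℕ} → c ≤ d → d ℕ.< ℓ → Near ℓ (shift p c) (shift p d)
  near-ordered p {c} {d} c≤d d<ℓ = subst (Near ℓ (shift p c))
    (trans (shift-shift p c (d ∸ c)) (cong (shift p) (m+[n∸m]≡n c≤d)))
    (near-shiftʳ (shift p c) (≤-<-trans (m∸n≤m d c) d<ℓ))

  near-window : (p : Fin M) {c d : ℕ} → c ℕ.< ℓ → d ℕ.< ℓ → Near ℓ (shift p c) (shift p d)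
  near-window p c<ℓ d<ℓ with ≤-total _ _
  ... | inj₁ c≤d = near-ordered p c≤d d<ℓ
  ... | inj₂ d≤c = near-sym (near-ordered p d≤c c<ℓ)

-- Positions excluded from a swap

-- Sets outside the ordering get the empty list, which disposes of the junk in `overlapping`.
fibre : ∀ {n M} → (Fin M → Subset n) → Subset n → List (Fin M)
fibre S A with Fin.any? (λ j → ≡-dec-Subset (S j) A)
... | yes (j , _) = [ j ]
... | no _ = []

length-fibre : ∀ {n M} (S : Fin M → Subset n) A → length (fibre S A) ≤ 1
length-fibre S A with Fin.any? (λ j → ≡-dec-Subset (S j) A)
... | yes _ = ≤-refl
... | no _ = z≤n

∈-fibre : ∀ {n M} (S : Fin M → Subset n) → (∀ i j → S i ≡ S j → i ≡ j) → ∀ j → j ∈ fibre S (S j)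
∈-fibre S injective j with Fin.any? (λ i → ≡-dec-Subset (S i) (S j))
... | yes (i , eq) = here (injective j i (sym eq))
... | no ∄i = contradiction (j , refl) ∄i

-- A pair (x , y) in [0 , k]² with sum above k dominates (k - b , b + 1) for some b < k.
sum≤ : ∀ {k x y} → x ≤ k → y ≤ k →
  (∀ (b : Fin k) → suc (toℕ b) ≤ y → ¬ (k ∸ toℕ b ≤ x)) → x ℕ.+ y ≤ k
sum≤ {k} {x} {zero} x≤k _ _ = subst (_≤ k) (sym (+-identityʳ x)) x≤k
sum≤ {k} {x} {suc c} _ c<k none = ≮⇒≥ λ k<x+y →
  none (Fin.fromℕ< c<k) (≤-reflexive (cong suc (Fin.toℕ-fromℕ< c<k)))
    (subst (λ c → k ∸ c ≤ x) (sym (Fin.toℕ-fromℕ< c<k))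
      (m≤n+o⇒m∸n≤o k c (ℕ.s≤s⁻¹ (subst (k ℕ.<_) (trans (+-suc x c) (cong suc (+-comm x c))) k<x+y))))

module Swap (k ℓ : ℕ) {n M : ℕ} (S : Fin M → Subset n) where

  -- Meant to catch every position whose k-set shares at least a points with X, leaving k - a points
  -- free.
  meeting : Subset n → ℕ → List (Fin M)
  meeting X a = union (fibre S) (overlapping X a (k ∸ a))

  -- What the set of j must satisfy to be put at position i. Since i is near itself, the first
  -- clause also makes the sets of i and j disjoint.
  Fits : Fin M → Fin M → Set
  Fits i j =
    (∀ q → Near ℓ i q → ∣ S j ∩ S q ∣ ≡ 0) ×
    (∀ q r s → Near ℓ i q → Near ℓ r s → ∣ S j ∩ S r ∣ ℕ.+ ∣ S q ∩ S s ∣ ≤ k)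

  -- Keeping i and j apart ensures that a swap never moves both ends of a near pair.
  Swappable : Fin M → Fin M → Set
  Swappable i j = ¬ Near ℓ i j × Fits i j × Fits j i

  -- Follows a chain from A: a position s whose set meets A in at least b + 1 points, a position r
  -- near s, and a position whose set meets that of r in at least k - b points.
  viaMeeting : (A : Subset n) → Fin k → List (Fin M)
  viaMeeting A b =
    union (λ s → union (λ r → meeting (S r) (k ∸ toℕ b)) (neighbours ℓ s)) (meeting A (suc (toℕ b)))

  -- Guards the second clause of `Fits i j`: the chain starts at a neighbour q of i and ends at j.
  clashing : Fin M → List (Fin M)
  clashing i = union (λ b → union (λ q → viaMeeting (S q) b) (neighbours ℓ i)) (allFin k)

  -- Guards the second clause of `Fits j i`: the chain starts at the set of i and ends at a
  -- neighbour q of j, so j comes last.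
  clashing˘ : Fin M → List (Fin M)
  clashing˘ i = union (λ b → union (neighbours ℓ) (viaMeeting (S i) b)) (allFin k)

  excluded : Fin M → List (Fin M)
  excluded i =
    neighbours ℓ i ++
    union (λ q → meeting (S q) 1) (neighbours ℓ i) ++
    union (neighbours ℓ) (meeting (S i) 1) ++
    clashing i ++
    clashing˘ i

  module _ (1≤k : 1 ≤ k) (∣S∣≡k : ∀ i → ∣ S i ∣ ≡ k) where

    length-meeting : ∀ i a → length (meeting (S i) a) ≤ k ^ a * n ^ (k ∸ a)
    length-meeting i a = subst (length (meeting (S i) a) ≤_) (*-identityʳ _)
      (length-union (fibre S) (overlapping (S i) a (k ∸ a))
        (subst (λ x → length (overlapping (S i) a (k ∸ a)) ≤ x ^ a * n ^ (k ∸ a)) (∣S∣≡k i) (length-overlapping (S i) a (k ∸ a)))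
        (length-fibre S))

    -- The exponents cancel: over all pairs of a (b+1)-overlap and a (k-b)-overlap
    -- there are only O(n^(k-1)) candidates, whatever b is.
    length-viaMeeting : ∀ i b →
      length (viaMeeting (S i) b) ≤ (ℓ ℕ.+ ℓ) * (k ^ suc k * n ^ (k ∸ 1))
    length-viaMeeting i b = ≤-trans
      (length-union _ _ (length-meeting i (suc c))
        λ s → length-union _ _ (length-neighbours ℓ s) λ r → length-meeting r (k ∸ c))
      (≤-reflexive (begin
        (k ^ suc c * n ^ (k ∸ suc c)) * ((ℓ ℕ.+ ℓ) * (k ^ (k ∸ c) * n ^ (k ∸ (k ∸ c))))
          ≡⟨ arrange (k ^ suc c) (n ^ (k ∸ suc c)) (ℓ ℕ.+ ℓ) (k ^ (k ∸ c)) (n ^ (k ∸ (k ∸ c))) ⟩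
        (ℓ ℕ.+ ℓ) * ((k ^ suc c * k ^ (k ∸ c)) * (n ^ (k ∸ suc c) * n ^ (k ∸ (k ∸ c))))
          ≡⟨ cong₂ (λ x y → (ℓ ℕ.+ ℓ) * (x * y)) (^-distribˡ-+-* k (suc c) (k ∸ c)) (^-distribˡ-+-* n (k ∸ suc c) (k ∸ (k ∸ c))) ⟨
        (ℓ ℕ.+ ℓ) * (k ^ (suc c ℕ.+ (k ∸ c)) * n ^ (k ∸ suc c ℕ.+ (k ∸ (k ∸ c))))
          ≡⟨ cong₂ (λ x y → (ℓ ℕ.+ ℓ) * (k ^ x * n ^ y)) (cong suc (m+[n∸m]≡n (<⇒≤ c<k))) exponent ⟩
        (ℓ ℕ.+ ℓ) * (k ^ suc k * n ^ (k ∸ 1)) ∎))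
      where
      open ≡-Reasoning
      c = toℕ b
      c<k = Fin.toℕ<n b
      arrange : ∀ x y z u v → (x * y) * (z * (u * v)) ≡ z * ((x * u) * (y * v))
      arrange = solve-∀
      exponent : k ∸ suc c ℕ.+ (k ∸ (k ∸ c)) ≡ k ∸ 1
      exponent = begin
        k ∸ suc c ℕ.+ (k ∸ (k ∸ c))   ≡⟨ cong (k ∸ suc c ℕ.+_) (m∸[m∸n]≡n (<⇒≤ c<k)) ⟩
        k ∸ suc c ℕ.+ c               ≡⟨ cong (ℕ._+ c) (∸-+-assoc k 1 c) ⟨
        k ∸ 1 ∸ c ℕ.+ c               ≡⟨ m∸n+n≡m (ℕ.s≤s⁻¹ (≤-trans c<k (≤-reflexive (sym (m+[n∸m]≡n 1≤k))))) ⟩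
        k ∸ 1                         ∎

    module _ (1≤ℓ : 1 ≤ ℓ) (1≤n : 1 ≤ n) where

      -- The 2 comes from the neighbours, 4k from the two lists for disjointness and the last term
      -- from the two lists of chains, each with k thresholds and (2ℓ)² choices of neighbours. Lower
      -- powers of ℓ and n are rounded up.
      length-excluded : ∀ i → length (excluded i) ≤
        (2 ℕ.+ 4 * k ℕ.+ 8 * k * k ^ suc k) * (ℓ ^ 2 * n ^ (k ∸ 1))
      length-excluded i = ≤-trans
        (length-++-≤ (neighbours ℓ i) _ (length-neighbours ℓ i) $
         length-++-≤ (union (λ q → meeting (S q) 1) (neighbours ℓ i)) _
           (length-union _ _ (length-neighbours ℓ i) λ q → length-meeting q 1) $
         length-++-≤ (union (neighbours ℓ) (meeting (S i) 1)) _
           (length-union _ _ (length-meeting i 1) (length-neighbours ℓ)) $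
         length-++-≤ (clashing i) (clashing˘ i)
           (length-union _ (allFin k) ∣allFin∣ λ b →
             length-union _ _ (length-neighbours ℓ i) λ q → length-viaMeeting q b)
           (length-union _ (allFin k) ∣allFin∣ λ b →
             length-union _ _ (length-viaMeeting i b) (length-neighbours ℓ)))
        (begin
          (ℓ ℕ.+ ℓ) ℕ.+ ((ℓ ℕ.+ ℓ) * (k * 1 * u) ℕ.+ (k * 1 * u * (ℓ ℕ.+ ℓ) ℕ.+
            (k * ((ℓ ℕ.+ ℓ) * ((ℓ ℕ.+ ℓ) * (c * u))) ℕ.+
             k * ((ℓ ℕ.+ ℓ) * (c * u) * (ℓ ℕ.+ ℓ)))))
            ≡⟨ collect ℓ k u c ⟩
          2 * ℓ ℕ.+ 4 * k * (ℓ * u) ℕ.+ 8 * k * c * (ℓ * (ℓ * 1) * u)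
            ≤⟨ +-monoˡ-≤ _ (+-mono-≤ (*-monoʳ-≤ 2 ℓ≤) (*-monoʳ-≤ (4 * k) (*-monoˡ-≤ u ℓ≤ℓ²))) ⟩
          2 * (ℓ ^ 2 * u) ℕ.+ 4 * k * (ℓ ^ 2 * u) ℕ.+ 8 * k * c * (ℓ ^ 2 * u)
            ≡⟨ factor 2 (4 * k) (8 * k * c) (ℓ ^ 2 * u) ⟩
          (2 ℕ.+ 4 * k ℕ.+ 8 * k * c) * (ℓ ^ 2 * u) ∎)
        where
        open ≤-Reasoning
        u c : ℕ
        u = n ^ (k ∸ 1)
        c = k ^ suc k
        instance
          _ : NonZero n
          _ = >-nonZero 1≤n
          _ : NonZero ℓ
          _ = >-nonZero 1≤ℓ
        ∣allFin∣ : length (allFin k) ≤ k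
        ∣allFin∣ = ≤-reflexive (List.length-tabulate id)
        ℓ≤ℓ² : ℓ ≤ ℓ ^ 2
        ℓ≤ℓ² = subst (_≤ ℓ ^ 2) (*-identityʳ ℓ) (*-monoʳ-≤ ℓ (m^n>0 ℓ 1))
        ℓ≤ : ℓ ≤ ℓ ^ 2 * u
        ℓ≤ = ≤-trans ℓ≤ℓ² (m≤m*n (ℓ ^ 2) u {{>-nonZero (m^n>0 n (k ∸ 1))}})
        collect : ∀ ℓ k u c →
          (ℓ ℕ.+ ℓ) ℕ.+ ((ℓ ℕ.+ ℓ) * (k * 1 * u) ℕ.+ (k * 1 * u * (ℓ ℕ.+ ℓ) ℕ.+
            (k * ((ℓ ℕ.+ ℓ) * ((ℓ ℕ.+ ℓ) * (c * u))) ℕ.+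
             k * ((ℓ ℕ.+ ℓ) * (c * u) * (ℓ ℕ.+ ℓ)))))
          ≡ 2 * ℓ ℕ.+ 4 * k * (ℓ * u) ℕ.+ 8 * k * c * (ℓ * (ℓ * 1) * u)
        collect = solve-∀
        factor : ∀ a b c x → a * x ℕ.+ b * x ℕ.+ c * x ≡ (a ℕ.+ b ℕ.+ c) * x
        factor = solve-∀

    module _ (injective : ∀ i j → S i ≡ S j → i ≡ j) where

      ∈-meeting : ∀ {j X} a → a ≤ k → a ≤ ∣ S j ∩ X ∣ → j ∈ meeting X a
      ∈-meeting {j} {X} a a≤k a≤∣∩∣ = ∈-union (fibre S)
        (∈-overlapping a (k ∸ a) (trans (∣S∣≡k j) (sym (m+[n∸m]≡n a≤k))) a≤∣∩∣)
        (∈-fibre S injective j)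

      ∈-viaMeeting : ∀ {r s j A} (b : Fin k) → suc (toℕ b) ≤ ∣ S s ∩ A ∣ → Near ℓ s r →
        k ∸ toℕ b ≤ ∣ S j ∩ S r ∣ → j ∈ viaMeeting A b
      ∈-viaMeeting b b<∣∩∣ near k-b≤∣∩∣ = ∈-union _
        (∈-meeting _ (Fin.toℕ<n b) b<∣∩∣)
        (∈-union _ near (∈-meeting _ (m∸n≤m k (toℕ b)) k-b≤∣∩∣))

      overlap≤k : ∀ p q → ∣ S p ∩ S q ∣ ≤ k
      overlap≤k p q = ≤-trans (∣p∩q∣≤∣p∣ (S p) (S q)) (≤-reflexive (∣S∣≡k p))

      ∉excluded⇒swappable : ∀ {i j} → j ∉ excluded i → Swappable i j
      ∉excluded⇒swappable {i} {j} j∉ =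
        j∉ ∘ ∈-++⁺ˡ ,
        ((λ q near → ≰1⇒≡0 λ meets → j∉ₗ₂ (∈-union _ near (∈-meeting 1 1≤k meets))) ,
         (λ q r s near near′ → sum≤ (overlap≤k j r) (overlap≤k q s) λ b b<∣q∩s∣ k-b≤∣j∩r∣ →
           j∉ₗ₄ (∈-union _ (∈-allFin b) (∈-union _ near
             (∈-viaMeeting b (subst (suc (toℕ b) ≤_) (∩-size-comm q s) b<∣q∩s∣) (near-sym near′) k-b≤∣j∩r∣))))) ,
        ((λ q near → ≰1⇒≡0 λ meets →
           j∉ₗ₃ (∈-union (neighbours ℓ) (∈-meeting 1 1≤k (subst (1 ≤_) (∩-size-comm i q) meets)) (near-sym near))) ,
         -- The sum is commuted so that the threshold b + 1 falls on the overlap with the set of i,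
         -- where the chain starts.
         (λ q r s near near′ → subst (_≤ k) (+-comm ∣ S q ∩ S s ∣ ∣ S i ∩ S r ∣)
           (sum≤ (overlap≤k q s) (overlap≤k i r) λ b b<∣i∩r∣ k-b≤∣q∩s∣ →
             j∉ₗ₅ (∈-union _ (∈-allFin b) (∈-union (neighbours ℓ)
               (∈-viaMeeting b (subst (suc (toℕ b) ≤_) (∩-size-comm i r) b<∣i∩r∣) near′ k-b≤∣q∩s∣)
               (near-sym near))))))
        where
        ≰1⇒≡0 : ∀ {x} → ¬ 1 ≤ x → x ≡ 0
        ≰1⇒≡0 = n<1⇒n≡0 ∘ ≰⇒>
        ∩-size-comm : ∀ p q → ∣ S p ∩ S q ∣ ≡ ∣ S q ∩ S p ∣
        ∩-size-comm p q = cong ∣_∣ (∩-comm (S p) (S q))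
        j∉₂ = j∉ ∘ ∈-++⁺ʳ (neighbours ℓ i)
        j∉ₗ₂ = j∉₂ ∘ ∈-++⁺ˡ
        j∉₃ = j∉₂ ∘ ∈-++⁺ʳ (union (λ q → meeting (S q) 1) (neighbours ℓ i))
        j∉ₗ₃ = j∉₃ ∘ ∈-++⁺ˡ
        j∉₄ = j∉₃ ∘ ∈-++⁺ʳ (union (neighbours ℓ) (meeting (S i) 1))
        j∉ₗ₄ = j∉₄ ∘ ∈-++⁺ˡ
        j∉ₗ₅ = j∉₄ ∘ ∈-++⁺ʳ (clashing i)

-- Improving an ordering by swaps

Good₁ : ∀ {n M} (ℓ : ℕ) → (Fin M → Subset n) → Fin M → Set
Good₁ ℓ S p = ∀ q → Near ℓ p q → p ≢ q → ∣ S p ∩ S q ∣ ≡ 0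

-- A condition on the single position p, so that positions can be repaired one by one; the other
-- three range over all quadruples containing p.
Good₂ : ∀ {n M} (k ℓ : ℕ) → (Fin M → Subset n) → Fin M → Set
Good₂ k ℓ S p = ∀ q r s → p ≢ q → p ≢ r → p ≢ s → q ≢ r → q ≢ s → r ≢ s →
  Near ℓ p q → Near ℓ r s → ∣ S p ∩ S r ∣ ℕ.+ ∣ S q ∩ S s ∣ ≤ k

-- The swapped ordering T is given by equations symmetric in i and j, so that each result for i also
-- serves for j.
module _ {n M k ℓ : ℕ} (1≤ℓ : 1 ≤ ℓ) {S T : Fin M → Subset n} {i j : Fin M}
  (swappable : Swap.Swappable k ℓ S i j)
  (Ti≡Sj : T i ≡ S j) (Tj≡Si : T j ≡ S i) (T≡S : ∀ x → x ≢ i → x ≢ j → T x ≡ S x) where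

  private
    ¬near = proj₁ swappable
    apart = proj₁ (proj₁ (proj₂ swappable))
    light = proj₂ (proj₁ (proj₂ swappable))

  swap-good₁ : Good₁ ℓ T i
  swap-good₁ q near i≢q with q Fin.≟ j
  ... | yes refl = contradiction near ¬near
  ... | no q≢j rewrite Ti≡Sj | T≡S q (≢-sym i≢q) q≢j = apart q near

  swap-good₂ : (∀ x → ∣ S x ∣ ≡ k) → Good₁ ℓ S i → Good₂ k ℓ T i
  swap-good₂ ∣S∣≡k good₁ q r s i≢q i≢r i≢s q≢r q≢s r≢s near near′
    with q Fin.≟ j | r Fin.≟ j | s Fin.≟ j
  ... | yes refl | _ | _ = contradiction near ¬near
  -- The first overlap is now that of the sets of j and i, which are disjoint; the other is at most
  -- k.
  ... | no q≢j | yes refl | _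
    rewrite Ti≡Sj | Tj≡Si | apart i (near-refl 1≤ℓ i)
          | T≡S q (≢-sym i≢q) q≢j | T≡S s (≢-sym i≢s) (≢-sym r≢s) =
    ≤-trans (∣p∩q∣≤∣p∣ (S q) (S s)) (≤-reflexive (∣S∣≡k q))
  -- The second overlap is that of the old sets of q and i, which vanishes by the first pass because
  -- q is near i.
  ... | no q≢j | no r≢j | yes refl
    rewrite Ti≡Sj | Tj≡Si | T≡S q (≢-sym i≢q) q≢j | T≡S r (≢-sym i≢r) r≢j
          | ∩-comm (S q) (S i) | good₁ q near i≢q | +-identityʳ ∣ S j ∩ S r ∣ =
    ≤-trans (∣p∩q∣≤∣p∣ (S j) (S r)) (≤-reflexive (∣S∣≡k j))
  ... | no q≢j | no r≢j | no s≢j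
    rewrite Ti≡Sj | T≡S q (≢-sym i≢q) q≢j | T≡S r (≢-sym i≢r) r≢j | T≡S s (≢-sym i≢s) s≢j =
    light q r s near near′

-- With P as goodness after the swap, this is the only information on the swap that the two
-- preservation lemmas use.
settled-or-unmoved : ∀ {A : Set} {M} {S T : Fin M → A} {i j : Fin M} {P : Fin M → Set} →
  (∀ x → x ≢ i → x ≢ j → T x ≡ S x) → P i → P j → ∀ x → P x ⊎ T x ≡ S x
settled-or-unmoved {i = i} {j} T≡S Pi Pj x with x Fin.≟ i | x Fin.≟ j
... | yes refl | _ = inj₁ Pi
... | no _ | yes refl = inj₁ Pj
... | no x≢i | no x≢j = inj₂ (T≡S x x≢i x≢j)

module _ {n M ℓ : ℕ} {S T : Fin M → Subset n} where

  good₁-preserved : (∀ x → Good₁ ℓ T x ⊎ T x ≡ S x) → ∀ p → Good₁ ℓ S p → Good₁ ℓ T p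
  good₁-preserved settled p goodS q near p≢q with settled p | settled q
  ... | inj₁ goodT | _ = goodT q near p≢q
  ... | inj₂ _ | inj₁ goodT =
    trans (cong ∣_∣ (∩-comm (T p) (T q))) (goodT p (near-sym near) (≢-sym p≢q))
  ... | inj₂ Tp≡Sp | inj₂ Tq≡Sq rewrite Tp≡Sp | Tq≡Sq = goodS q near p≢q

  -- The sum is invariant under (q, p, s, r), (r, s, p, q) and (s, r, q, p), so any settled position
  -- can be brought to the front, where its goodness gives the bound. If none is settled, no set in
  -- the quadruple has changed.
  good₂-preserved : ∀ {k} → (∀ x → Good₂ k ℓ T x ⊎ T x ≡ S x) → ∀ p → Good₂ k ℓ S p → Good₂ k ℓ T p
  good₂-preserved {k} settled p goodS q r s p≢q p≢r p≢s q≢r q≢s r≢s near near′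
    with settled p | settled q | settled r | settled s
  ... | inj₁ goodT | _ | _ | _ = goodT q r s p≢q p≢r p≢s q≢r q≢s r≢s near near′
  ... | inj₂ _ | inj₁ goodT | _ | _ =
    subst (_≤ k) (+-comm ∣ T q ∩ T s ∣ ∣ T p ∩ T r ∣)
      (goodT p s r (≢-sym p≢q) q≢s q≢r p≢s p≢r (≢-sym r≢s) (near-sym near) (near-sym near′))
  ... | inj₂ _ | inj₂ _ | inj₁ goodT | _ =
    subst₂ (λ A B → ∣ A ∣ ℕ.+ ∣ B ∣ ≤ k) (∩-comm (T r) (T p)) (∩-comm (T s) (T q))
      (goodT s p q r≢s (≢-sym p≢r) (≢-sym q≢r) (≢-sym p≢s) (≢-sym q≢s) p≢q near′ near)
  ... | inj₂ _ | inj₂ _ | inj₂ _ | inj₁ goodT =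
    subst (_≤ k) (+-comm ∣ T q ∩ T s ∣ ∣ T p ∩ T r ∣)
      (subst₂ (λ A B → ∣ A ∣ ℕ.+ ∣ B ∣ ≤ k) (∩-comm (T s) (T q)) (∩-comm (T r) (T p))
        (goodT r q p (≢-sym r≢s) (≢-sym q≢s) (≢-sym p≢s) (≢-sym q≢r) (≢-sym p≢r) (≢-sym p≢q)
          (near-sym near′) (near-sym near)))
  ... | inj₂ Tp | inj₂ Tq | inj₂ Tr | inj₂ Ts rewrite Tp | Tq | Tr | Ts =
    goodS q r s p≢q p≢r p≢s q≢r q≢s r≢s near near′

-- Transposing two entries of an ordering

transpose-ˡ : ∀ {M} (i j : Fin M) → transpose i j i ≡ j
transpose-ˡ i j rewrite dec-true (i Fin.≟ i) refl = refl

transpose-ʳ : ∀ {M} (i j : Fin M) → transpose i j j ≡ i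
transpose-ʳ i j with j Fin.≟ i
... | yes j≡i = j≡i
... | no _ rewrite dec-true (j Fin.≟ j) refl = refl

transpose-other : ∀ {M} (i j : Fin M) {x} → x ≢ i → x ≢ j → transpose i j x ≡ x
transpose-other i j {x} x≢i x≢j rewrite dec-false (x Fin.≟ i) x≢i | dec-false (x Fin.≟ j) x≢j = refl

transpose-CyclicOrdering : ∀ {n k M} {S : Fin M → Subset n} i j →
  CyclicOrdering n k S → CyclicOrdering n k (S ∘ transpose i j)
transpose-CyclicOrdering {S = S} i j (∣S∣≡k , injective , surjective) =
  (λ x → ∣S∣≡k (transpose i j x)) ,
  (λ x y eq → trans (sym (transpose-inverse j i))
    (trans (cong (transpose j i) (injective _ _ eq)) (transpose-inverse j i))) ,
  λ A ∣A∣≡k → let x , Sx≡A = surjective A ∣A∣≡k in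
    transpose j i x , trans (cong S (transpose-inverse i j)) Sx≡A

-- One sweep over all positions suffices because a step never spoils a position repaired earlier.
-- Both passes are instances, with different invariants.
improve-everywhere : ∀ {X : Set} {M} (Inv : X → Set) (Good : X → Fin M → Set) →
  (∀ S i → Inv S → ∃[ T ] (Inv T × Good T i × (∀ p → Good S p → Good T p))) →
  ∀ S → Inv S → ∃[ T ] (Inv T × (∀ p → Good T p))
improve-everywhere {X} {M} Inv Good step S inv =
  let T , inv′ , good = along (allFin M) in T , inv′ , λ p → good p (∈-allFin p)
  where
  along : ∀ xs → ∃[ T ] (Inv T × (∀ p → p ∈ xs → Good T p))
  along [] = S , inv , λ _ ()
  along (x ∷ xs) =
    let T , invT , goodT = along xs
        U , invU , goodUx , preserved = step T x invT
    in U , invU , λ { p (here refl) → goodUx ; p (there p∈xs) → preserved p (goodT p p∈xs) }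

module _ {n k ℓ M : ℕ} (1≤ℓ : 1 ≤ ℓ) {S : Fin M → Subset n} {i j : Fin M}
  (swappable : Swap.Swappable k ℓ S i j) where

  private
    T : Fin M → Subset n
    T = S ∘ transpose i j
    swappable˘ : Swap.Swappable k ℓ S j i
    swappable˘ = let ¬near , fits , fits˘ = swappable in ¬near ∘ near-sym , fits˘ , fits
    at-i : T i ≡ S j
    at-i = cong S (transpose-ˡ i j)
    at-j : T j ≡ S i
    at-j = cong S (transpose-ʳ i j)
    elsewhere : ∀ x → x ≢ i → x ≢ j → T x ≡ S x
    elsewhere x x≢i x≢j = cong S (transpose-other i j x≢i x≢j)

  transpose-good₁ : Good₁ ℓ (S ∘ transpose i j) i
  transpose-good₁ = swap-good₁ 1≤ℓ swappable at-i at-j elsewhere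

  transpose-preserves-good₁ : ∀ p → Good₁ ℓ S p → Good₁ ℓ (S ∘ transpose i j) p
  transpose-preserves-good₁ = good₁-preserved (settled-or-unmoved elsewhere transpose-good₁
    (swap-good₁ 1≤ℓ swappable˘ at-j at-i λ x x≢j x≢i → elsewhere x x≢i x≢j))

  module _ (∣S∣≡k : ∀ x → ∣ S x ∣ ≡ k) (good₁ : ∀ p → Good₁ ℓ S p) where

    transpose-good₂ : Good₂ k ℓ (S ∘ transpose i j) i
    transpose-good₂ = swap-good₂ 1≤ℓ swappable at-i at-j elsewhere ∣S∣≡k (good₁ i)

    transpose-preserves-good₂ : ∀ p → Good₂ k ℓ S p → Good₂ k ℓ (S ∘ transpose i j) p
    transpose-preserves-good₂ = good₂-preserved (settled-or-unmoved elsewhere transpose-good₂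
      (swap-good₂ 1≤ℓ swappable˘ at-j at-i (λ x x≢j x≢i → elsewhere x x≢i x≢j) ∣S∣≡k (good₁ j)))

-- The two passes

module _ {n k ℓ M : ℕ} (1≤k : 1 ≤ k) (1≤ℓ : 1 ≤ ℓ) (1≤n : 1 ≤ n)
  (few : (2 ℕ.+ 4 * k ℕ.+ 8 * k * k ^ suc k) * (ℓ ^ 2 * n ^ (k ∸ 1)) ℕ.< M) where

  opaque
    -- By `few` the excluded list has fewer than M entries, so it misses some position.
    partner : ∀ {S : Fin M → Subset n} → CyclicOrdering n k S → ∀ i → ∃[ j ] Swap.Swappable k ℓ S i j
    partner {S} (∣S∣≡k , injective , _) i =
      let j , j∉ = short-list-misses (excluded i) (≤-<-trans (length-excluded 1≤k ∣S∣≡k 1≤ℓ 1≤n i) few)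
      in j , ∉excluded⇒swappable 1≤k ∣S∣≡k injective j∉
      where open Swap k ℓ S

  disjointOrdering : Σ (Fin M → Subset n) (CyclicOrdering n k) →
    Σ (Fin M → Subset n) λ S → CyclicOrdering n k S × (∀ p → Good₁ ℓ S p)
  disjointOrdering (S , ordering) = improve-everywhere (CyclicOrdering n k) (Good₁ ℓ) step S ordering
    where
    step : ∀ S i → CyclicOrdering n k S →
      ∃[ T ] (CyclicOrdering n k T × Good₁ ℓ T i × (∀ p → Good₁ ℓ S p → Good₁ ℓ T p))
    step S i ord with j , swappable ← partner ord i =
      S ∘ transpose i j , transpose-CyclicOrdering i j ord ,
      transpose-good₁ 1≤ℓ {S = S} swappable , transpose-preserves-good₁ 1≤ℓ {S = S} swappable

  -- The second pass carries the disjointness from the first as part of its invariant; every swap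
  -- preserves it.
  goodOrdering : Σ (Fin M → Subset n) (CyclicOrdering n k) →
    Σ (Fin M → Subset n) λ S → (CyclicOrdering n k S × (∀ p → Good₁ ℓ S p)) × (∀ p → Good₂ k ℓ S p)
  goodOrdering initial =
    let S , inv = disjointOrdering initial in improve-everywhere Inv (Good₂ k ℓ) step S inv
    where
    Inv : (Fin M → Subset n) → Set
    Inv S = CyclicOrdering n k S × (∀ p → Good₁ ℓ S p)
    step : ∀ S i → Inv S → ∃[ T ] (Inv T × Good₂ k ℓ T i × (∀ p → Good₂ k ℓ S p → Good₂ k ℓ T p))
    step S i (ord , good₁) with j , swappable ← partner ord i =
      S ∘ transpose i j ,
      (transpose-CyclicOrdering i j ord , λ p → transpose-preserves-good₁ 1≤ℓ {S = S} swappable p (good₁ p)) ,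
      transpose-good₂ 1≤ℓ {S = S} swappable (proj₁ ord) good₁ ,
      transpose-preserves-good₂ 1≤ℓ {S = S} swappable (proj₁ ord) good₁

  -- Keeps a window from wrapping around onto itself, so its entries sit at distinct positions.
  ℓ<M : ℓ ℕ.< M
  ℓ<M = ≤-<-trans (begin
    ℓ                           ≡⟨ *-identityʳ ℓ ⟨
    ℓ * 1                       ≤⟨ *-monoʳ-≤ ℓ (m^n>0 ℓ 1) ⟩
    ℓ ^ 2                       ≤⟨ m≤m*n (ℓ ^ 2) (n ^ (k ∸ 1)) {{>-nonZero (m^n>0 n (k ∸ 1))}} ⟩
    ℓ ^ 2 * n ^ (k ∸ 1)         ≤⟨ m≤n*m _ (2 ℕ.+ 4 * k ℕ.+ 8 * k * k ^ suc k) ⟩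
    _                           ∎) few
    where
    open ≤-Reasoning
    instance
      _ : NonZero n
      _ = >-nonZero 1≤n
      _ : NonZero ℓ
      _ = >-nonZero 1≤ℓ

  module _ {S : Fin M → Subset n} (ordering : CyclicOrdering n k S) where

    windows-parpartition : (∀ p → Good₁ ℓ S p) → ∀ i → IsParpartition k ℓ (Window ℓ S i)
    windows-parpartition good₁ i =
      (λ t → proj₁ ordering _) ,
      λ t u t≢u → ∣p∣≡0⇒Empty (good₁ _ _ (near-window i (Fin.toℕ<n t) (Fin.toℕ<n u))
        λ eq → t≢u (Fin.toℕ-injective (shift-injective i (below t) (below u) eq)))
      where
      below : (t : Fin ℓ) → toℕ t ℕ.< M
      below t = <-trans (Fin.toℕ<n t) ℓ<M

    windows-not-close : ∀ α β → 1ℚ ℚ.≤ α + β → (∀ p → Good₂ k ℓ S p) →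
      ∀ i j → NoCommonSet (Window ℓ S i) (Window ℓ S j) → ¬ Close α β k (Window ℓ S i) (Window ℓ S j)
    windows-not-close α β 1≤α+β good₂ i j noCommon
      (_ , _ , _ , _ , (t , refl) , (u , refl) , A₁≢B₁ , (v , refl) , (w , refl) , A₂≢B₂ , αk< , βk<) =
      <⇒≱ (fractions-exceed {α} {β} {a = common t v} {b = common u w} 1≤α+β αk< βk<)
        -- The quadruple is A₁, B₁, A₂, B₂: positions within a window differ because the sets do,
        -- and positions across the windows differ because no set is common.
        (good₂ _ _ _ _ (A₁≢B₁ ∘ cong S) (apart t v) (apart t w) (apart u v) (apart u w) (A₂≢B₂ ∘ cong S)
          (near-window i (Fin.toℕ<n t) (Fin.toℕ<n u)) (near-window j (Fin.toℕ<n v) (Fin.toℕ<n w)))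
      where
      common : Fin ℓ → Fin ℓ → ℕ
      common t v = ∣ Window ℓ S i t ∩ Window ℓ S j v ∣
      apart : ∀ t v → shift i (toℕ t) ≢ shift j (toℕ v)
      apart t v eq = noCommon _ (t , refl) (v , cong S (sym eq))

-- The exceptional list is short for large n

few-excluded : ∀ {k ℓ n} K → 1 ≤ k → 1 ≤ ℓ → 1 ≤ n → 2 * k ≤ n →
  suc (K * (2 ^ k * k !)) * ℓ ^ 2 ≤ n → K * (ℓ ^ 2 * n ^ (k ∸ 1)) ℕ.< n C k
few-excluded {k} {ℓ} {n} K 1≤k 1≤ℓ 1≤n 2k≤n bound = *-cancelˡ-< E _ _ (begin-strict
  -- The `suc` in the hypothesis supplies one spare positive w, which makes the inequality strict.
  E * (K * w)                       <⟨ m<n+m (E * (K * w)) w>0 ⟩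
  w ℕ.+ E * (K * w)                 ≡⟨ arrange E K (ℓ ^ 2) u ⟩
  (suc (K * E) * ℓ ^ 2) * u         ≤⟨ *-monoˡ-≤ u bound ⟩
  n * u                             ≡⟨ cong (n ^_) (m+[n∸m]≡n 1≤k) ⟩
  n ^ k                             ≤⟨ n^k≤2^k*k!*nCk n k 2k≤n ⟩
  E * (n C k)                       ∎)
  where
  open ≤-Reasoning
  E u w : ℕ
  E = 2 ^ k * k !
  u = n ^ (k ∸ 1)
  w = ℓ ^ 2 * u
  instance
    _ : NonZero n
    _ = >-nonZero 1≤n
    _ : NonZero ℓ
    _ = >-nonZero 1≤ℓ
  w>0 : 0 ℕ.< w
  w>0 = *-mono-≤ (m^n>0 ℓ 2) (m^n>0 n (k ∸ 1))
  arrange : ∀ e c x u → x * u ℕ.+ e * (c * (x * u)) ≡ (suc (c * e) * x) * u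
  arrange = solve-∀

theorem7 : ∀ (k : ℕ) → 1 ≤ k →
    ∀ (α β : ℚ) → 0ℚ < α → α < 1ℚ → 0ℚ < β → β < 1ℚ → Data.Rational._≤_ 1ℚ (α + β) →
    ∀ (ℓ : ℕ → ℕ) → (∀ n → 1 ≤ ℓ n) → SqrtLittleO ℓ →
    ∃[ N ] (∀ (n : ℕ) → N ≤ n →
    Σ (Fin (n C k) → Subset n) λ S →
    CyclicOrdering n k S ×
    (∀ i → IsParpartition k (ℓ n) (Window (ℓ n) S i)) ×
    (∀ i j → NoCommonSet (Window (ℓ n) S i) (Window (ℓ n) S j) →
    ¬ Close α β k (Window (ℓ n) S i) (Window (ℓ n) S j)))
theorem7 k 1≤k α β _ _ _ _ 1≤α+β ℓ 1≤ℓ ℓ≪√n =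
  -- The bound 2k serves the lower estimate of C(n, k) and also gives n ≥ 1.
  N ⊔ 2 * k , λ n N≤n →
    let 2k≤n = ≤-trans (m≤n⊔m N (2 * k)) N≤n
        1≤n = ≤-trans (≤-trans 1≤k (m≤n*m k 2)) 2k≤n
        few = few-excluded K 1≤k (1≤ℓ n) 1≤n 2k≤n (bound n (≤-trans (m≤m⊔n N (2 * k)) N≤n))
        S , (ordering , good₁) , good₂ = goodOrdering 1≤k (1≤ℓ n) 1≤n few (initialOrdering n k)
    in S , ordering ,
       windows-parpartition 1≤k (1≤ℓ n) 1≤n few ordering good₁ ,
       windows-not-close 1≤k (1≤ℓ n) 1≤n few ordering α β 1≤α+β good₂
  where
  K : ℕ
  K = 2 ℕ.+ 4 * k ℕ.+ 8 * k * k ^ suc k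
  N : ℕ
  -- The growth hypothesis is used for one constant only: one more than the coefficient K of the
  -- excluded list times the loss 2^k k! in the binomial estimate.
  N = proj₁ (ℓ≪√n (suc (K * (2 ^ k * k !))) (s≤s z≤n))
  bound : ∀ n → N ≤ n → suc (K * (2 ^ k * k !)) * ℓ n ^ 2 ≤ n
  bound = proj₂ (ℓ≪√n (suc (K * (2 ^ k * k !))) (s≤s z≤n))
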